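{- The class of matroids with an adjoint is minor-closed; that is, if a matroid $M$ has an adjoint and $N$ is a minor of $M$, then $N$ has an adjoint.
   Context: Matroid terminology follows Oxley's book; in particular matroids are finite. $\mathcal{F}(M)$ denotes the collection of flats of a matroid $M$. A hyperplane of $M$ is a flat of rank $r(M)-1$; a point is a flat of rank $1$ (in a simple matroid, the points are exactly the singletons of elements of the ground set, and are identified with the elements). Definition. Let $M$ be a matroid, and let $M'$ be a simple matroid with the same rank as $M$. Then $M'$ is an adjoint of $M$ if there is a map $\phi:\mathcal{F}(M)\rightarrow\mathcal{F}(M')$ such that (i) $\phi$ is injective; (ii) if $F_1,F_2\in\mathcal{F}(M)$ and $F_1\subseteq F_2$, then $\phi(F_2)\subseteq\phi(F_1)$; and (iii) $\phi$ restricts to a bijection from the set of hyperplanes of $M$ onto the set of points of $M'$. Such a map $\phi$ is called an adjoint map from $M$ to $M'$. A matroid has an adjoint if some such $M'$ exists. -}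

module Defs where

open import Data.Empty using (⊥-elim)
open import Data.Fin using (Fin)
open import Data.Fin.Subset
open import Data.Fin.Subset.Properties
open import Data.Nat using (ℕ; suc; _+_; _∸_; _≤_; _<_; _≟_; _<?_)
open import Data.Nat.Induction using (Acc; acc; <-wellFounded)
open import Data.Nat.Properties
  using (≤-trans; <⇒≱; ≮⇒≥; +-comm; +-suc; +-mono-≤; +-monoˡ-≤; +-monoˡ-<;
         +-cancelʳ-<; ∸-monoʳ-<; module ≤-Reasoning)
open import Data.Product using (∃; ∃-syntax; ∃!; Σ-syntax; _×_; _,_; proj₁; proj₂)
open import Data.Refinement using (Refinement; value)
open import Data.Sum using (inj₁; inj₂; [_,_]′)
open import Data.Vec using ([]; _∷_; here; there; tabulate)
open import Function using (_∘_; _⇔_; Injective)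
open import Relation.Binary.PropositionalEquality
  using (_≡_; _≢_; refl; sym; trans; cong; subst)
open import Relation.Nullary using (¬_; yes; no; does; ¬?; _×-dec_)
open import Relation.Unary using (Decidable)

private
  variable
    n m : ℕ
    p q : Subset n

x∈p─q⇒x∉q : ∀ {x : Fin n} (p q : Subset n) → x ∈ p ─ q → x ∉ q
x∈p─q⇒x∉q (_ ∷ p) (outside ∷ q) here       ()
x∈p─q⇒x∉q (_ ∷ p) (inside ∷ q)  (there x∈) (there x∈q) = x∈p─q⇒x∉q p q x∈ x∈q
x∈p─q⇒x∉q (_ ∷ p) (outside ∷ q) (there x∈) (there x∈q) = x∈p─q⇒x∉q p q x∈ x∈q

∣p∣≡∣p∩q∣+∣p─q∣ : (p q : Subset n) → ∣ p ∣ ≡ ∣ p ∩ q ∣ + ∣ p ─ q ∣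
∣p∣≡∣p∩q∣+∣p─q∣ []            []            = refl
∣p∣≡∣p∩q∣+∣p─q∣ (outside ∷ p) (outside ∷ q) = ∣p∣≡∣p∩q∣+∣p─q∣ p q
∣p∣≡∣p∩q∣+∣p─q∣ (outside ∷ p) (inside  ∷ q) = ∣p∣≡∣p∩q∣+∣p─q∣ p q
∣p∣≡∣p∩q∣+∣p─q∣ (inside  ∷ p) (outside ∷ q) =
  trans (cong suc (∣p∣≡∣p∩q∣+∣p─q∣ p q)) (sym (+-suc _ _))
∣p∣≡∣p∩q∣+∣p─q∣ (inside  ∷ p) (inside  ∷ q) = cong suc (∣p∣≡∣p∩q∣+∣p─q∣ p q)

p⊂p∪⁅x⁆ : ∀ {x : Fin n} → x ∉ p → p ⊂ p ∪ ⁅ x ⁆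
p⊂p∪⁅x⁆ {p = p} {x = x} x∉p =
  p⊆p∪q ⁅ x ⁆ , x , q⊆p∪q p ⁅ x ⁆ (x∈⁅x⁆ x) , x∉p

p∪⁅x⁆⊆q : ∀ {x : Fin n} → p ⊆ q → x ∈ q → p ∪ ⁅ x ⁆ ⊆ q
p∪⁅x⁆⊆q {p = p} {q = q} {x} p⊆q x∈q y∈ with x∈p∪q⁻ p ⁅ x ⁆ y∈
... | inj₁ y∈p = p⊆q y∈p
... | inj₂ y∈x = subst (_∈ q) (sym (x∈⁅y⁆⇒x≡y x y∈x)) x∈q

-- The ground set is an arbitrary subset E of Fin n, so that a minor of a matroid
-- keeps the labels of its elements.
record Matroid (n : ℕ) : Set₁ where
  field
    E            : Subset n
    Indep        : Subset n → Set
    indep?       : Decidable Indep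
    indep⊆E      : ∀ {I} → Indep I → I ⊆ E
    ∅-indep      : Indep ⊥
    hereditary   : ∀ {I J} → Indep J → I ⊆ J → Indep I
    augmentation : ∀ {I J} → Indep I → Indep J → ∣ I ∣ < ∣ J ∣ →
                   ∃[ e ] e ∈ J × e ∉ I × Indep (I ∪ ⁅ e ⁆)

open Matroid public

infix 4 _≈_
infixl 6 _∖_ _↾_ _/_

_≈_ : Matroid n → Matroid n → Set
M ≈ N = E M ≡ E N × (∀ I → Indep M I ⇔ Indep N I)

_∖_ : Matroid n → Subset n → Matroid n
M ∖ T = record
  { E            = E M ─ T
  ; Indep        = λ I → I ⊆ E M ─ T × Indep M I
  ; indep?       = λ I → (I ⊆? (E M ─ T)) ×-dec indep? M I
  ; indep⊆E      = proj₁
  ; ∅-indep      = ⊆-min _ , ∅-indep M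
  ; hereditary   = λ (J⊆ , J-ind) I⊆J → (J⊆ ∘ I⊆J) , hereditary M J-ind I⊆J
  ; augmentation = λ (I⊆ , I-ind) (J⊆ , J-ind) I<J →
      let e , e∈J , e∉I , ind = augmentation M I-ind J-ind I<J
      in e , e∈J , e∉I , p∪⁅x⁆⊆q I⊆ (J⊆ e∈J) , ind
  }

_↾_ : Matroid n → Subset n → Matroid n
M ↾ X = M ∖ (E M ─ X)

IsBasis : Matroid n → Subset n → Set
IsBasis M B = Indep M B × ¬ (∃[ C ] Indep M C × B ⊂ C)

module _ (M : Matroid n) where

  isBasis? : Decidable (IsBasis M)
  isBasis? B = indep? M B ×-dec ¬? (anySubset? λ C → indep? M C ×-dec (B ⊂? C))

  ∃basis : ∃ (IsBasis M)
  ∃basis = go ⊥ (∅-indep M) (<-wellFounded _)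
    where
    go : ∀ I → Indep M I → Acc _<_ (n ∸ ∣ I ∣) → ∃ (IsBasis M)
    go I I-ind (acc rec) with anySubset? (λ C → indep? M C ×-dec (I ⊂? C))
    ... | no  max                 = I , I-ind , max
    ... | yes (C , C-ind , I⊂C) =
      go C C-ind (rec (∸-monoʳ-< (p⊂q⇒∣p∣<∣q∣ I⊂C) (∣p∣≤n C)))

  indep≤basis : ∀ {I B} → Indep M I → IsBasis M B → ∣ I ∣ ≤ ∣ B ∣
  indep≤basis {I} {B} I-ind (B-ind , max) = ≮⇒≥ λ B<I →
    let e , _ , e∉B , ind = augmentation M B-ind I-ind B<I
    in max (B ∪ ⁅ e ⁆ , ind , p⊂p∪⁅x⁆ e∉B)

  large-indep⇒basis : ∀ {I B} → Indep M I → IsBasis M B → ∣ B ∣ ≤ ∣ I ∣ → IsBasis M I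
  large-indep⇒basis I-ind B-bas B≤I = I-ind , λ (C , C-ind , I⊂C) →
    <⇒≱ (p⊂q⇒∣p∣<∣q∣ I⊂C) (≤-trans (indep≤basis C-ind B-bas) B≤I)

  extend : ∀ {I J} → Indep M I → Indep M J →
           ∃[ K ] I ⊆ K × K ⊆ I ∪ J × Indep M K × ∣ J ∣ ≤ ∣ K ∣
  extend {I₀} {J} I₀-ind J-ind =
    go I₀ (λ x∈ → x∈) (p⊆p∪q J) I₀-ind (<-wellFounded _)
    where
    go : ∀ I → I₀ ⊆ I → I ⊆ I₀ ∪ J → Indep M I → Acc _<_ (n ∸ ∣ I ∣) →
         ∃[ K ] I₀ ⊆ K × K ⊆ I₀ ∪ J × Indep M K × ∣ J ∣ ≤ ∣ K ∣
    go I I₀⊆I I⊆ I-ind (acc rec) with ∣ I ∣ <? ∣ J ∣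
    ... | no  I≮J = I , I₀⊆I , I⊆ , I-ind , ≮⇒≥ I≮J
    ... | yes I<J =
      let e , e∈J , e∉I , ind = augmentation M I-ind J-ind I<J
          I⊂Ie = p⊂p∪⁅x⁆ e∉I
      in go (I ∪ ⁅ e ⁆) (proj₁ I⊂Ie ∘ I₀⊆I) (p∪⁅x⁆⊆q I⊆ (q⊆p∪q I₀ J e∈J)) ind
            (rec (∸-monoʳ-< (p⊂q⇒∣p∣<∣q∣ I⊂Ie) (∣p∣≤n (I ∪ ⁅ e ⁆))))

  -- The bases of the dual are the sets E ─ B for B a basis of M.
  CoIndep : Subset n → Set
  CoIndep I = ∃[ B ] IsBasis M B × I ⊆ E M ─ B

  coIndep-augmentation : ∀ {I J} → CoIndep I → CoIndep J → ∣ I ∣ < ∣ J ∣ →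
                         ∃[ e ] e ∈ J × e ∉ I × CoIndep (I ∪ ⁅ e ⁆)
  coIndep-augmentation {I} {J} (B , B-bas , I⊆) (B′ , B′-bas , J⊆) I<J
    with extend {B′ ─ I} {B} (hereditary M (proj₁ B′-bas) (p─q⊆p B′ I)) (proj₁ B-bas)
  ... | K , B′─I⊆K , K⊆ , K-ind , B≤K with nonempty? (J ─ I ─ K)
  ... | yes (e , e∈) =
        e , p─q⊆p J I e∈J─I , x∈p─q⇒x∉q J I e∈J─I ,
        K , large-indep⇒basis K-ind B-bas B≤K ,
        p∪⁅x⁆⊆q I⊆E─K (x∈p∧x∉q⇒x∈p─q (p─q⊆p (E M) B′ (J⊆ (p─q⊆p J I e∈J─I)))
                                      (x∈p─q⇒x∉q (J ─ I) K e∈))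
        where
        e∈J─I : e ∈ J ─ I
        e∈J─I = p─q⊆p (J ─ I) K e∈
        I⊆E─K : I ⊆ E M ─ K
        I⊆E─K x∈I = x∈p∧x∉q⇒x∈p─q (p─q⊆p (E M) B (I⊆ x∈I)) λ x∈K →
          [ (λ x∈ → x∈p─q⇒x∉q B′ I x∈ x∈I) , x∈p─q⇒x∉q (E M) B (I⊆ x∈I) ]′
            (x∈p∪q⁻ (B′ ─ I) B (K⊆ x∈K))
  ... | no  none = ⊥-elim (<⇒≱ B′<K (indep≤basis K-ind B′-bas))
        where
        J─I⊆K : J ─ I ⊆ K
        J─I⊆K {x} x∈ with x ∈? K
        ... | yes x∈K = x∈K
        ... | no  x∉K = ⊥-elim (none (x , x∈p∧x∉q⇒x∈p─q x∈ x∉K))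
        J∩I⊆I─B′ : J ∩ I ⊆ I ─ B′
        J∩I⊆I─B′ x∈ = let x∈J , x∈I = x∈p∩q⁻ J I x∈ in
          x∈p∧x∉q⇒x∈p─q x∈I (x∈p─q⇒x∉q (E M) B′ (J⊆ x∈J))
        J─I⊆K─[B′─I] : J ─ I ⊆ K ─ (B′ ─ I)
        J─I⊆K─[B′─I] x∈ = x∈p∧x∉q⇒x∈p─q (J─I⊆K x∈) λ x∈B′ →
          x∈p─q⇒x∉q (E M) B′ (J⊆ (p─q⊆p J I x∈)) (p─q⊆p B′ I x∈B′)
        B′∩I<J─I : ∣ B′ ∩ I ∣ < ∣ J ─ I ∣
        B′∩I<J─I = +-cancelʳ-< (∣ I ─ B′ ∣) _ _ (begin-strict
          ∣ B′ ∩ I ∣ + ∣ I ─ B′ ∣ ≡⟨ cong (λ S → ∣ S ∣ + ∣ I ─ B′ ∣) (∩-comm B′ I) ⟩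
          ∣ I ∩ B′ ∣ + ∣ I ─ B′ ∣ ≡⟨ sym (∣p∣≡∣p∩q∣+∣p─q∣ I B′) ⟩
          ∣ I ∣                   <⟨ I<J ⟩
          ∣ J ∣                   ≡⟨ ∣p∣≡∣p∩q∣+∣p─q∣ J I ⟩
          ∣ J ∩ I ∣ + ∣ J ─ I ∣   ≤⟨ +-monoˡ-≤ _ (p⊆q⇒∣p∣≤∣q∣ J∩I⊆I─B′) ⟩
          ∣ I ─ B′ ∣ + ∣ J ─ I ∣  ≡⟨ +-comm (∣ I ─ B′ ∣) _ ⟩
          ∣ J ─ I ∣ + ∣ I ─ B′ ∣  ∎)
          where open ≤-Reasoning
        B′<K : ∣ B′ ∣ < ∣ K ∣
        B′<K = begin-strict
          ∣ B′ ∣                                  ≡⟨ ∣p∣≡∣p∩q∣+∣p─q∣ B′ I ⟩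
          ∣ B′ ∩ I ∣ + ∣ B′ ─ I ∣                 <⟨ +-monoˡ-< _ B′∩I<J─I ⟩
          ∣ J ─ I ∣ + ∣ B′ ─ I ∣                  ≤⟨ +-mono-≤ (p⊆q⇒∣p∣≤∣q∣ J─I⊆K─[B′─I])
                                                       (p⊆q⇒∣p∣≤∣q∣ λ x∈ → x∈p∩q⁺ (B′─I⊆K x∈ , x∈)) ⟩
          ∣ K ─ (B′ ─ I) ∣ + ∣ K ∩ (B′ ─ I) ∣     ≡⟨ +-comm (∣ K ─ (B′ ─ I) ∣) _ ⟩
          ∣ K ∩ (B′ ─ I) ∣ + ∣ K ─ (B′ ─ I) ∣     ≡⟨ sym (∣p∣≡∣p∩q∣+∣p─q∣ K (B′ ─ I)) ⟩
          ∣ K ∣                                   ∎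
          where open ≤-Reasoning

  dual : Matroid n
  dual = record
    { E            = E M
    ; Indep        = CoIndep
    ; indep?       = λ I → anySubset? λ B → isBasis? B ×-dec (I ⊆? (E M ─ B))
    ; indep⊆E      = λ (B , _ , I⊆) → p─q⊆p (E M) B ∘ I⊆
    ; ∅-indep      = let B , B-bas = ∃basis in B , B-bas , ⊆-min _
    ; hereditary   = λ (B , B-bas , J⊆) I⊆J → B , B-bas , J⊆ ∘ I⊆J
    ; augmentation = coIndep-augmentation
    }

_/_ : Matroid n → Subset n → Matroid n
M / T = dual (dual M ∖ T)

-- N is obtained from M by a finite sequence of deletions and contractions, where
-- matroids with the same ground set and independent sets count as equal.
data _IsMinorOf_ (N M : Matroid n) : Set where
  equal    : N ≈ M → N IsMinorOf M
  delete   : ∀ T → T ⊆ E M → N IsMinorOf (M ∖ T) → N IsMinorOf M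
  contract : ∀ T → T ⊆ E M → N IsMinorOf (M / T) → N IsMinorOf M

module _ (M : Matroid n) where

  -- All bases of a matroid have the same cardinality (by indep≤basis), so the
  -- choice made by ∃basis is immaterial.
  rank : ℕ
  rank = ∣ proj₁ (∃basis M) ∣

  rankOf : Subset n → ℕ
  rankOf X = ∣ proj₁ (∃basis (M ↾ X)) ∣

  closure : Subset n → Subset n
  closure X = tabulate λ e →
    does ((e ∈? E M) ×-dec (rankOf (X ∪ ⁅ e ⁆) ≟ rankOf X))

  -- As closure X ⊆ E M for every X, flats are subsets of the ground set.
  IsFlat : Subset n → Set
  IsFlat X = closure X ≡ X

  -- The proof component is irrelevant: flats are equal when their underlying sets are.
  Flat : Set
  Flat = Refinement (Subset n) IsFlat

  -- Not rankOf (value H) ≡ rank ∸ 1: a matroid of rank 0 has no hyperplanes.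
  IsHyperplane : Flat → Set
  IsHyperplane H = suc (rankOf (value H)) ≡ rank

  IsPoint : Flat → Set
  IsPoint P = rankOf (value P) ≡ 1

  IsCircuit : Subset n → Set
  IsCircuit C = C ⊆ E M × ¬ Indep M C × (∀ D → D ⊂ C → Indep M D)

  IsSimple : Set
  IsSimple = (∀ e → ¬ IsCircuit ⁅ e ⁆) ×
             (∀ e f → e ≢ f → ¬ IsCircuit (⁅ e ⁆ ∪ ⁅ f ⁆))

record IsAdjointMap (M : Matroid n) (M′ : Matroid m) (φ : Flat M → Flat M′) : Set where
  field
    injective : Injective _≡_ _≡_ φ
    antitone  : ∀ F₁ F₂ → value F₁ ⊆ value F₂ → value (φ F₂) ⊆ value (φ F₁)
    hyperplane⇒point : ∀ H → IsHyperplane M H → IsPoint M′ (φ H)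
    point⇒hyperplane : ∀ P → IsPoint M′ P → ∃! _≡_ λ H → IsHyperplane M H × φ H ≡ P

record IsAdjoint (M : Matroid n) (M′ : Matroid m) : Set where
  field
    simple     : IsSimple M′
    same-rank  : rank M′ ≡ rank M
    adjointMap : ∃ (IsAdjointMap M M′)

HasAdjoint : Matroid n → Set₁
HasAdjoint M = ∃[ m ] Σ[ M′ ∈ Matroid m ] IsAdjoint M M′

{-# OPTIONS --safe #-}

-- An adjoint map φ takes a flat of rank k to a flat of rank r(M) − k, as a maximal chain of flats
-- is mapped to a strict chain. It follows by descent on the rank of G that φ(G) ⊆ φ(F) only if
-- F ⊆ G. Every minor N of M is a restriction of some M / C such that E(N) spans M / C. Let P
-- consist of the points φ(cl(H ∪ C)) for the hyperplanes H of N. Then M′ | P is an adjoint of N,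
-- with the adjoint map F ↦ φ(cl(F ∪ C)) ∩ P. The point is that P is large enough: if e ∉ cl(X)
-- in N, then a hyperplane of N that contains X and avoids e yields a point of P that lies in
-- φ(cl(X ∪ C)) but not in φ(cl(X ∪ e ∪ C)), so φ(cl(F ∪ C)) ∩ P spans φ(cl(F ∪ C)).

module Submission where

open import Defs
open import Data.Bool using (true)
import Data.Bool.Properties as Bool
open import Data.Empty using (⊥-elim)
open import Data.Fin using (Fin)
open import Data.Fin.Subset
open import Data.Fin.Subset.Properties
open import Data.Irrelevant using ([_])
open import Data.Nat using (ℕ; zero; suc; _+_; _∸_; _≤_; _<_; z≤n; s≤s; s≤s⁻¹)
open import Data.Nat.Properties
open import Data.Product using (∃!; ∃-syntax; _×_; _,_; proj₁; proj₂)
open import Data.Refinement using (value; value-injective) renaming (_,_ to _,ᵣ_)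
open import Data.Sum using (inj₁; inj₂; [_,_]′)
open import Data.Vec using (tabulate)
open import Data.Vec.Properties using (lookup∘tabulate; lookup⇒[]=; []=⇒lookup; ≡-dec)
open import Function using (_∘_; Equivalence; Injective)
open import Relation.Binary.PropositionalEquality
  using (_≡_; refl; sym; trans; cong; cong₂; subst; subst₂; module ≡-Reasoning)
open import Relation.Nullary using (Dec; does; yes; no; _×-dec_; recompute)
open import Relation.Nullary.Decidable using (dec-true; decidable-stable)
open import Relation.Unary using (Decidable)

private
  variable
    n m : ℕ
    X Y Z : Subset n
    e : Fin n

-- Finite subsets.

comprehension : {P : Fin n → Set} → Decidable P → Subset n
comprehension P? = tabulate (does ∘ P?)

∈-comprehension⁺ : {P : Fin n → Set} (P? : Decidable P) → P e → e ∈ comprehension P?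
∈-comprehension⁺ {e = e} P? Pe = lookup⇒[]= e _ (trans (lookup∘tabulate _ e) (dec-true (P? e) Pe))

∈-comprehension⁻ : {P : Fin n → Set} (P? : Decidable P) → e ∈ comprehension P? → P e
∈-comprehension⁻ {e = e} P? e∈ = witness (P? e) (trans (sym (lookup∘tabulate _ e)) ([]=⇒lookup e∈))
  where
  witness : {A : Set} (a? : Dec A) → does a? ≡ true → A
  witness (yes a) refl = a

∪-least : X ⊆ Z → Y ⊆ Z → X ∪ Y ⊆ Z
∪-least {X = X} {Y = Y} X⊆Z Y⊆Z = [ X⊆Z , Y⊆Z ]′ ∘ x∈p∪q⁻ X Y

∪-mono : {X Y Z W : Subset n} → X ⊆ Y → Z ⊆ W → X ∪ Z ⊆ Y ∪ W
∪-mono {Y = Y} {W = W} X⊆Y Z⊆W = ∪-least (p⊆p∪q W ∘ X⊆Y) (q⊆p∪q Y W ∘ Z⊆W)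

∪-swap : (X Y Z : Subset n) → X ∪ Y ∪ Z ≡ (X ∪ Z) ∪ Y
∪-swap X Y Z = trans (cong (X ∪_) (∪-comm Y Z)) (sym (∪-assoc X Z Y))

⁅x⁆⊆p : e ∈ X → ⁅ e ⁆ ⊆ X
⁅x⁆⊆p {X = X} e∈X x∈ = subst (_∈ X) (sym (x∈⁅y⁆⇒x≡y _ x∈)) e∈X

p─[p─q]⊆q : (X Y : Subset n) → X ─ (X ─ Y) ⊆ Y
p─[p─q]⊆q X Y {x} x∈ with x ∈? Y
... | yes x∈Y = x∈Y
... | no  x∉Y = ⊥-elim (x∈p─q⇒x∉q X (X ─ Y) x∈
                         (x∈p∧x∉q⇒x∈p─q (p─q⊆p X (X ─ Y) x∈) x∉Y))

x∈p∧x∈q⇒x∈p─[p─q] : (X Y : Subset n) → e ∈ X → e ∈ Y → e ∈ X ─ (X ─ Y)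
x∈p∧x∈q⇒x∈p─[p─q] X Y e∈X e∈Y = x∈p∧x∉q⇒x∈p─q e∈X λ e∈X─Y → x∈p─q⇒x∉q X Y e∈X─Y e∈Y

p⊆[p─q]∪q : (X Y : Subset n) → X ⊆ (X ─ Y) ∪ Y
p⊆[p─q]∪q X Y {x} x∈X with x ∈? Y
... | yes x∈Y = q⊆p∪q (X ─ Y) Y x∈Y
... | no  x∉Y = p⊆p∪q Y (x∈p∧x∉q⇒x∈p─q x∈X x∉Y)

p─[p─q]≡q : (X Y : Subset n) → Y ⊆ X → X ─ (X ─ Y) ≡ Y
p─[p─q]≡q X Y Y⊆X = ⊆-antisym (p─[p─q]⊆q X Y) λ x∈ → x∈p∧x∈q⇒x∈p─[p─q] X Y (Y⊆X x∈) x∈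

∣q∣+∣p─q∣≡∣p∣ : (X Y : Subset n) → Y ⊆ X → ∣ Y ∣ + ∣ X ─ Y ∣ ≡ ∣ X ∣
∣q∣+∣p─q∣≡∣p∣ X Y Y⊆X = trans
  (cong (λ Z → ∣ Z ∣ + ∣ X ─ Y ∣) (⊆-antisym (λ x∈ → x∈p∩q⁺ (Y⊆X x∈ , x∈)) (p∩q⊆q X Y)))
  (sym (∣p∣≡∣p∩q∣+∣p─q∣ X Y))

0<∣p∣⇒nonempty : (X : Subset n) → 0 < ∣ X ∣ → Nonempty X
0<∣p∣⇒nonempty {n} X 0<X with nonempty? X
... | yes ne    = ne
... | no  empty = ⊥-elim (<-irrefl (trans (sym (∣⊥∣≡0 n)) (cong ∣_∣ (sym (Empty-unique empty)))) 0<X)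

-- The rank function.

module Rank (M : Matroid n) where

  -- Opaque, as otherwise rankOf unfolds to a search over all subsets.
  opaque
    r : Subset n → ℕ
    r = rankOf M

    r≡rankOf : ∀ X → r X ≡ rankOf M X
    r≡rankOf X = refl

    basisOf : ∀ X → ∃[ I ] Indep M I × I ⊆ X × ∣ I ∣ ≡ r X
    basisOf X =
      let I , (I⊆ , I-ind) , _ = ∃basis (M ↾ X)
      in I , I-ind , p─[p─q]⊆q (E M) X ∘ I⊆ , refl

    indep≤rank : ∀ I X → Indep M I → I ⊆ X → ∣ I ∣ ≤ r X
    indep≤rank I X I-ind I⊆X = indep≤basis (M ↾ X)
      ((λ x∈ → x∈p∧x∈q⇒x∈p─[p─q] (E M) X (indep⊆E M I-ind x∈) (I⊆X x∈)) , I-ind)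
      (proj₂ (∃basis (M ↾ X)))

  indep⇒rank : ∀ I → Indep M I → r I ≡ ∣ I ∣
  indep⇒rank I I-ind = let J , _ , J⊆I , ∣J∣≡ = basisOf I in
    ≤-antisym (subst (_≤ ∣ I ∣) ∣J∣≡ (p⊆q⇒∣p∣≤∣q∣ J⊆I)) (indep≤rank I I I-ind ⊆-refl)

  basisOf⊇ : ∀ I X → Indep M I → I ⊆ X → ∃[ J ] I ⊆ J × J ⊆ X × Indep M J × ∣ J ∣ ≡ r X
  basisOf⊇ I X I-ind I⊆X =
    let J , J-ind , J⊆X , ∣J∣≡ = basisOf X
        K , I⊆K , K⊆ , K-ind , J≤K = extend M I-ind J-ind
        K⊆X : K ⊆ X
        K⊆X = ∪-least I⊆X J⊆X ∘ K⊆
    in K , I⊆K , K⊆X , K-ind , ≤-antisym (indep≤rank K X K-ind K⊆X) (subst (_≤ ∣ K ∣) ∣J∣≡ J≤K)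

  rank-mono : ∀ X Y → X ⊆ Y → r X ≤ r Y
  rank-mono X Y X⊆Y = let I , I-ind , I⊆X , ∣I∣≡ = basisOf X in
    subst (_≤ r Y) ∣I∣≡ (indep≤rank I Y I-ind (X⊆Y ∘ I⊆X))

  rank≤∣∣ : ∀ X → r X ≤ ∣ X ∣
  rank≤∣∣ X = let _ , _ , I⊆X , ∣I∣≡ = basisOf X in subst (_≤ ∣ X ∣) ∣I∣≡ (p⊆q⇒∣p∣≤∣q∣ I⊆X)

  rank-⊥ : r ⊥ ≡ 0
  rank-⊥ = n≤0⇒n≡0 (subst (r ⊥ ≤_) (∣⊥∣≡0 n) (rank≤∣∣ ⊥))

  r≤rank : ∀ X → r X ≤ rank M
  r≤rank X = let I , I-ind , _ , ∣I∣≡ = basisOf X in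
    subst (_≤ rank M) ∣I∣≡ (indep≤basis M I-ind (proj₂ (∃basis M)))

  rank-E : r (E M) ≡ rank M
  rank-E = let B , B-ind , _ = ∃basis M in
    ≤-antisym (r≤rank (E M)) (indep≤rank B (E M) B-ind (indep⊆E M B-ind))

  -- Submodularity for `X ⊆ Y`. For nested bases `I ⊆ J ⊆ K` of `X`, `Y` and `Y ∪ Z`, maximality of
  -- `J` in `Y` puts `K ─ J` inside `Z`, so `I ∪ (K ─ J)` is independent in `X ∪ Z`.
  diminishing-returns : ∀ X Y Z → X ⊆ Y → r (Y ∪ Z) + r X ≤ r (X ∪ Z) + r Y
  diminishing-returns X Y Z X⊆Y
    with I , I-ind , I⊆X , ∣I∣≡ ← basisOf X
    with J , I⊆J , J⊆Y , J-ind , ∣J∣≡ ← basisOf⊇ I Y I-ind (X⊆Y ∘ I⊆X)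
    with K , J⊆K , K⊆ , K-ind , ∣K∣≡ ← basisOf⊇ J (Y ∪ Z) J-ind (p⊆p∪q Z ∘ J⊆Y) = begin
      r (Y ∪ Z) + r X                    ≡⟨ cong₂ _+_ (sym ∣K∣≡) (sym ∣I∣≡) ⟩
      ∣ K ∣ + ∣ I ∣                      ≡⟨ cong (_+ ∣ I ∣) (∣p∣≡∣p∩q∣+∣p─q∣ K J) ⟩
      ∣ K ∩ J ∣ + ∣ K ─ J ∣ + ∣ I ∣      ≤⟨ +-monoˡ-≤ ∣ I ∣ (+-monoˡ-≤ ∣ K ─ J ∣ (∣p∩q∣≤∣q∣ K J)) ⟩
      ∣ J ∣ + ∣ K ─ J ∣ + ∣ I ∣          ≡⟨ +-assoc ∣ J ∣ _ _ ⟩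
      ∣ J ∣ + (∣ K ─ J ∣ + ∣ I ∣)        ≡⟨ +-comm ∣ J ∣ _ ⟩
      ∣ K ─ J ∣ + ∣ I ∣ + ∣ J ∣          ≡⟨ cong (_+ ∣ J ∣) (+-comm ∣ K ─ J ∣ _) ⟩
      ∣ I ∣ + ∣ K ─ J ∣ + ∣ J ∣          ≤⟨ +-monoˡ-≤ ∣ J ∣ I+K─J≤L ⟩
      ∣ L ∣ + ∣ J ∣                      ≤⟨ +-mono-≤ (indep≤rank L (X ∪ Z) L-ind L⊆) (≤-reflexive ∣J∣≡) ⟩
      r (X ∪ Z) + r Y                    ∎
    where
    open ≤-Reasoning
    L : Subset n
    L = I ∪ (K ─ J)
    L-ind : Indep M L
    L-ind = hereditary M K-ind (∪-least (J⊆K ∘ I⊆J) (p─q⊆p K J))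
    I+K─J≤L : ∣ I ∣ + ∣ K ─ J ∣ ≤ ∣ L ∣
    I+K─J≤L = begin
      ∣ I ∣ + ∣ K ─ J ∣          ≤⟨ +-mono-≤ (p⊆q⇒∣p∣≤∣q∣ (λ x∈ → x∈p∩q⁺ (p⊆p∪q (K ─ J) x∈ , I⊆J x∈)))
                                       (p⊆q⇒∣p∣≤∣q∣ λ x∈ → x∈p∧x∉q⇒x∈p─q (q⊆p∪q I (K ─ J) x∈) (x∈p─q⇒x∉q K J x∈)) ⟩
      ∣ L ∩ J ∣ + ∣ L ─ J ∣      ≡⟨ sym (∣p∣≡∣p∩q∣+∣p─q∣ L J) ⟩
      ∣ L ∣                      ∎
    K─J⊆Z : K ─ J ⊆ Z
    K─J⊆Z {x} x∈ with x∈p∪q⁻ Y Z (K⊆ (p─q⊆p K J x∈))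
    ... | inj₂ x∈Z = x∈Z
    ... | inj₁ x∈Y = ⊥-elim (<⇒≱ (p⊂q⇒∣p∣<∣q∣ (p⊂p∪⁅x⁆ (x∈p─q⇒x∉q K J x∈))) (begin
      ∣ J ∪ ⁅ x ⁆ ∣  ≤⟨ indep≤rank (J ∪ ⁅ x ⁆) Y (hereditary M K-ind (p∪⁅x⁆⊆q J⊆K (p─q⊆p K J x∈)))
                          (p∪⁅x⁆⊆q J⊆Y x∈Y) ⟩
      r Y            ≡⟨ sym ∣J∣≡ ⟩
      ∣ J ∣          ∎))
    L⊆ : L ⊆ X ∪ Z
    L⊆ = ∪-mono I⊆X K─J⊆Z

  rank-∪≤ : ∀ X Z → r (X ∪ Z) ≤ r X + ∣ Z ∣
  rank-∪≤ X Z = let I , I-ind , I⊆ , ∣I∣≡ = basisOf (X ∪ Z) in begin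
    r (X ∪ Z)                  ≡⟨ sym ∣I∣≡ ⟩
    ∣ I ∣                      ≡⟨ ∣p∣≡∣p∩q∣+∣p─q∣ I X ⟩
    ∣ I ∩ X ∣ + ∣ I ─ X ∣      ≤⟨ +-mono-≤ (indep≤rank (I ∩ X) X (hereditary M I-ind (p∩q⊆p I X)) (p∩q⊆q I X))
                                    (p⊆q⇒∣p∣≤∣q∣ λ x∈ → [ ⊥-elim ∘ x∈p─q⇒x∉q I X x∈ , (λ x∈Z → x∈Z) ]′
                                      (x∈p∪q⁻ X Z (I⊆ (p─q⊆p I X x∈)))) ⟩
    r X + ∣ Z ∣                ∎
    where open ≤-Reasoning

  rank-∪⁅⁆≤ : ∀ X e → r (X ∪ ⁅ e ⁆) ≤ suc (r X)
  rank-∪⁅⁆≤ X e = begin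
    r (X ∪ ⁅ e ⁆)     ≤⟨ rank-∪≤ X ⁅ e ⁆ ⟩
    r X + ∣ ⁅ e ⁆ ∣   ≡⟨ cong (r X +_) (∣⁅x⁆∣≡1 e) ⟩
    r X + 1           ≡⟨ +-comm (r X) 1 ⟩
    suc (r X)         ∎
    where open ≤-Reasoning

  -- Augment a basis of `X` from a basis of `Y`. As `Y` may contain labels outside the ground set,
  -- `e ∈ E M` is returned as well.
  gain : ∀ X Y → r X < r Y →
         ∃[ e ] e ∈ Y × e ∈ E M × r (X ∪ ⁅ e ⁆) ≡ suc (r X)
  gain X Y rX<rY =
    let I , I-ind , I⊆X , ∣I∣≡ = basisOf X
        J , J-ind , J⊆Y , ∣J∣≡ = basisOf Y
        e , e∈J , e∉I , Ie-ind = augmentation M I-ind J-ind (subst₂ _<_ (sym ∣I∣≡) (sym ∣J∣≡) rX<rY)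
    in e , J⊆Y e∈J , indep⊆E M J-ind e∈J ,
       ≤-antisym (rank-∪⁅⁆≤ X e) (begin
         suc (r X)          ≡⟨ cong suc (sym ∣I∣≡) ⟩
         suc ∣ I ∣          ≤⟨ p⊂q⇒∣p∣<∣q∣ (p⊂p∪⁅x⁆ e∉I) ⟩
         ∣ I ∪ ⁅ e ⁆ ∣      ≤⟨ indep≤rank (I ∪ ⁅ e ⁆) (X ∪ ⁅ e ⁆) Ie-ind (∪-mono I⊆X ⊆-refl) ⟩
         r (X ∪ ⁅ e ⁆)      ∎)
    where open ≤-Reasoning

  shrink : ∀ X {k} → r X ≡ suc k → ∃[ Y ] Y ⊆ X × r Y ≡ k
  shrink X {k} rX≡ =
    let I , I-ind , I⊆X , ∣I∣≡ = basisOf X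
        I≡ = trans ∣I∣≡ rX≡
        e , e∈I = 0<∣p∣⇒nonempty I (subst (0 <_) (sym I≡) (s≤s z≤n))
    in I - e , I⊆X ∘ p─q⊆p I ⁅ e ⁆ ,
       ≤-antisym
         (s≤s⁻¹ (begin
           suc (r (I - e))  ≤⟨ s≤s (rank≤∣∣ (I - e)) ⟩
           suc ∣ I - e ∣    ≤⟨ x∈p⇒∣p-x∣<∣p∣ e∈I ⟩
           ∣ I ∣            ≡⟨ I≡ ⟩
           suc k            ∎))
         (s≤s⁻¹ (begin
           suc k                    ≡⟨ sym I≡ ⟩
           ∣ I ∣                    ≤⟨ indep≤rank I _ I-ind (p⊆[p─q]∪q I ⁅ e ⁆) ⟩
           r ((I - e) ∪ ⁅ e ⁆)      ≤⟨ rank-∪⁅⁆≤ (I - e) e ⟩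
           suc (r (I - e))          ∎))
    where open ≤-Reasoning

  no-gain-mono : ∀ X Y e → X ⊆ Y → r (X ∪ ⁅ e ⁆) ≤ r X → r (Y ∪ ⁅ e ⁆) ≤ r Y
  no-gain-mono X Y e X⊆Y ≤rX = +-cancelʳ-≤ (r X) _ _ (begin
    r (Y ∪ ⁅ e ⁆) + r X   ≤⟨ diminishing-returns X Y ⁅ e ⁆ X⊆Y ⟩
    r (X ∪ ⁅ e ⁆) + r Y   ≤⟨ +-monoˡ-≤ (r Y) ≤rX ⟩
    r X + r Y             ≡⟨ +-comm (r X) (r Y) ⟩
    r Y + r X             ∎)
    where open ≤-Reasoning

  -- Closure, flats and hyperplanes.

  opaque
    unfolding r

    ∈closure⁻ : ∀ X {e} → e ∈ closure M X → e ∈ E M × r (X ∪ ⁅ e ⁆) ≡ r X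
    ∈closure⁻ X = ∈-comprehension⁻ (λ e → (e ∈? E M) ×-dec (r (X ∪ ⁅ e ⁆) ≟ r X))

    ∈closure⁺ : ∀ X {e} → e ∈ E M → r (X ∪ ⁅ e ⁆) ≤ r X → e ∈ closure M X
    ∈closure⁺ X {e} e∈E ≤rX = ∈-comprehension⁺ (λ e → (e ∈? E M) ×-dec (r (X ∪ ⁅ e ⁆) ≟ r X))
      (e∈E , ≤-antisym ≤rX (rank-mono X (X ∪ ⁅ e ⁆) (p⊆p∪q ⁅ e ⁆)))

  ∉closure⇒gain : ∀ X {e} → e ∈ E M → e ∉ closure M X → r (X ∪ ⁅ e ⁆) ≡ suc (r X)
  ∉closure⇒gain X {e} e∈E e∉ = ≤-antisym (rank-∪⁅⁆≤ X e) (≰⇒> (e∉ ∘ ∈closure⁺ X e∈E))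

  closure⊆E : ∀ X → closure M X ⊆ E M
  closure⊆E X = proj₁ ∘ ∈closure⁻ X

  ∈⇒∈closure : ∀ X {e} → e ∈ E M → e ∈ X → e ∈ closure M X
  ∈⇒∈closure X e∈E e∈X = ∈closure⁺ X e∈E (rank-mono (X ∪ _) X (p∪⁅x⁆⊆q ⊆-refl e∈X))

  closure-mono : ∀ X Y → X ⊆ Y → closure M X ⊆ closure M Y
  closure-mono X Y X⊆Y e∈ = let e∈E , ≡rX = ∈closure⁻ X e∈ in
    ∈closure⁺ Y e∈E (no-gain-mono X Y _ X⊆Y (≤-reflexive ≡rX))

  rank-∪closure : ∀ X → r (X ∪ closure M X) ≤ r X
  rank-∪closure X = ≮⇒≥ λ rX< →
    let e , e∈ , _ , gained = gain X (X ∪ closure M X) rX<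
    in <-irrefl gained (s≤s ([ (λ e∈X → rank-mono _ X (p∪⁅x⁆⊆q ⊆-refl e∈X))
                             , ≤-reflexive ∘ proj₂ ∘ ∈closure⁻ X ]′ (x∈p∪q⁻ X _ e∈)))

  rank-closure : ∀ X → r (closure M X) ≡ r X
  rank-closure X = let I , I-ind , I⊆X , ∣I∣≡ = basisOf X in ≤-antisym
    (≤-trans (rank-mono _ _ (q⊆p∪q X (closure M X))) (rank-∪closure X))
    (subst (_≤ r (closure M X)) ∣I∣≡ (indep≤rank I (closure M X) I-ind
      λ e∈I → ∈⇒∈closure X (indep⊆E M I-ind e∈I) (I⊆X e∈I)))

  -- `Y` may contain labels outside `E M`, and these are missing from `closure M Y`; the comparison
  -- therefore runs through `Y ∪ closure M Y`, whose rank is that of `Y`.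
  closure-least : ∀ X Y → X ⊆ closure M Y → closure M X ⊆ closure M Y
  closure-least X Y X⊆ {e} e∈ = let e∈E , ≡rX = ∈closure⁻ X e∈ in ∈closure⁺ Y e∈E (begin
    r (Y ∪ ⁅ e ⁆)                   ≤⟨ rank-mono _ _ (∪-mono (p⊆p∪q (closure M Y)) ⊆-refl) ⟩
    r ((Y ∪ closure M Y) ∪ ⁅ e ⁆)   ≤⟨ no-gain-mono X (Y ∪ closure M Y) e (q⊆p∪q Y _ ∘ X⊆) (≤-reflexive ≡rX) ⟩
    r (Y ∪ closure M Y)             ≤⟨ rank-∪closure Y ⟩
    r Y                             ∎)
    where open ≤-Reasoning

  closure-isFlat : ∀ X → IsFlat M (closure M X)
  closure-isFlat X = ⊆-antisym (closure-least (closure M X) X ⊆-refl)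
    λ e∈ → ∈⇒∈closure (closure M X) (closure⊆E X e∈) e∈

  flat⊆E : ∀ {F} → IsFlat M F → F ⊆ E M
  flat⊆E {F} F-flat = subst (_⊆ E M) F-flat (closure⊆E F)

  flat-∋ : ∀ F {e} → IsFlat M F → e ∈ E M → r (F ∪ ⁅ e ⁆) ≤ r F → e ∈ F
  flat-∋ F F-flat e∈E ≤rF = subst (_ ∈_) F-flat (∈closure⁺ F e∈E ≤rF)

  flat⊇closure : ∀ X F → IsFlat M F → X ⊆ F → closure M X ⊆ F
  flat⊇closure X F F-flat X⊆F = subst (closure M X ⊆_) F-flat (closure-mono X F X⊆F)

  ⊆closure : ∀ X Y → Y ⊆ E M → X ⊆ Y → r Y ≤ r X → Y ⊆ closure M X
  ⊆closure X Y Y⊆E X⊆Y rY≤rX e∈Y =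
    ∈closure⁺ X (Y⊆E e∈Y) (≤-trans (rank-mono _ Y (p∪⁅x⁆⊆q X⊆Y e∈Y)) rY≤rX)

  -- The flatness proof stored in a `Flat` is irrelevant; it is recovered by deciding equality of
  -- subsets.
  isFlat : (F : Flat M) → IsFlat M (value F)
  isFlat (F ,ᵣ [ F-flat ]) = recompute (≡-dec Bool._≟_ (closure M F) F) F-flat

  closureFlat : Subset n → Flat M
  closureFlat X = closure M X ,ᵣ [ closure-isFlat X ]

  -- Induction on the corank `k` of `X ∪ ⁅ e ⁆`: elements that raise the rank of `X ∪ ⁅ e ⁆` are
  -- added to `X` until that set spans. `Y` only generates the hyperplane, which is `closure M Y`.
  hyperplane-avoiding : ∀ k X e → k + r (X ∪ ⁅ e ⁆) ≡ rank M → r (X ∪ ⁅ e ⁆) ≡ suc (r X) → X ⊆ E M →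
    ∃[ Y ] X ⊆ Y × Y ⊆ E M × suc (r Y) ≡ rank M × e ∉ closure M Y
  hyperplane-avoiding zero    X e rank≡ gained X⊆E =
    X , ⊆-refl , X⊆E , trans (sym gained) rank≡ ,
    λ e∈ → <-irrefl (trans (sym (proj₂ (∈closure⁻ X e∈))) gained) (n<1+n (r X))
  hyperplane-avoiding (suc k) X e rank≡ gained X⊆E
    with f , f∈E , _ , gained-f ← gain (X ∪ ⁅ e ⁆) (E M)
           (subst (r (X ∪ ⁅ e ⁆) <_) (trans rank≡ (sym rank-E)) (s≤s (m≤n+m _ k)))
    = let Y , Xf⊆Y , rest = hyperplane-avoiding k Xf e
            (trans (cong (k +_) rXfe≡) (trans (+-suc k _) rank≡))
            (trans rXfe≡ (cong suc (trans gained (sym rXf≡))))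
            (p∪⁅x⁆⊆q X⊆E f∈E)
      in Y , Xf⊆Y ∘ p⊆p∪q ⁅ f ⁆ , rest
    where
    Xf : Subset n
    Xf = X ∪ ⁅ f ⁆
    rXfe≡ : r (Xf ∪ ⁅ e ⁆) ≡ suc (r (X ∪ ⁅ e ⁆))
    rXfe≡ = trans (cong r (trans (∪-assoc X ⁅ f ⁆ ⁅ e ⁆) (∪-swap X ⁅ f ⁆ ⁅ e ⁆))) gained-f
    -- `e` and `f` together raise the rank of `X` by two, and `e` adds at most one to `Xf`, so `f`
    -- alone already adds one.
    rXf≡ : r Xf ≡ suc (r X)
    rXf≡ = ≤-antisym (rank-∪⁅⁆≤ X f)
      (s≤s⁻¹ (subst (_≤ suc (r Xf)) (trans rXfe≡ (cong suc gained)) (rank-∪⁅⁆≤ Xf e)))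

-- Order-reversing injections between lattices of flats.

module OrderReversing (M : Matroid n) (M′ : Matroid m) (φ : Flat M → Flat M′)
  (same-rank : rank M′ ≡ rank M)
  (φ-injective : Injective _≡_ _≡_ φ)
  (φ-antitone : ∀ F G → value F ⊆ value G → value (φ G) ⊆ value (φ F)) where

  open Rank M
  private module M′ = Rank M′

  -- `φ` composed with closure, so that it applies to arbitrary sets and flatness proofs need not be
  -- carried along.
  ρ : Subset n → Subset m
  ρ X = value (φ (closureFlat X))

  ρ-isFlat : ∀ X → IsFlat M′ (ρ X)
  ρ-isFlat X = M′.isFlat (φ (closureFlat X))

  ρ⊆E : ∀ X → ρ X ⊆ E M′
  ρ⊆E X = M′.flat⊆E (ρ-isFlat X)

  ρ-antitone : ∀ X Y → closure M X ⊆ closure M Y → ρ Y ⊆ ρ X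
  ρ-antitone X Y = φ-antitone (closureFlat X) (closureFlat Y)

  ρ-injective : ∀ X Y → ρ X ≡ ρ Y → closure M X ≡ closure M Y
  ρ-injective X Y eq = cong value (φ-injective (value-injective eq))

  ρ⊆ρ∧rank≤⇒closure≡ : ∀ X Y → ρ Y ⊆ ρ X → M′.r (ρ X) ≤ M′.r (ρ Y) → closure M X ≡ closure M Y
  ρ⊆ρ∧rank≤⇒closure≡ X Y ρY⊆ρX ≤rρY = ρ-injective X Y (⊆-antisym
    (subst (ρ X ⊆_) (ρ-isFlat Y) (M′.⊆closure (ρ Y) (ρ X) (ρ⊆E X) ρY⊆ρX ≤rρY)) ρY⊆ρX)

  ρ-strict : ∀ X Y → X ⊆ Y → r X < r Y → M′.r (ρ Y) < M′.r (ρ X)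
  ρ-strict X Y X⊆Y rX<rY = ≰⇒> λ rρX≤rρY → <-irrefl (begin-equality
    r X                ≡⟨ sym (rank-closure X) ⟩
    r (closure M X)    ≡⟨ cong r (ρ⊆ρ∧rank≤⇒closure≡ X Y (ρ-antitone X Y (closure-mono X Y X⊆Y)) rρX≤rρY) ⟩
    r (closure M Y)    ≡⟨ rank-closure Y ⟩
    r Y                ∎) rX<rY
    where open ≤-Reasoning

  -- Along a chain from `X` up to a spanning set, the image under `ρ` loses rank at each of the `k`
  -- steps.
  corank≤rank-ρ : ∀ k X → k + r X ≡ rank M → k ≤ M′.r (ρ X)
  corank≤rank-ρ zero    X _     = z≤n
  corank≤rank-ρ (suc k) X rank≡ =
    let e , _ , _ , gained = gain X (E M)
          (subst (r X <_) (trans rank≡ (sym rank-E)) (s≤s (m≤n+m (r X) k)))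
        k≤ = corank≤rank-ρ k (X ∪ ⁅ e ⁆) (trans (cong (k +_) gained) (trans (+-suc k (r X)) rank≡))
    in ≤-<-trans k≤ (ρ-strict X (X ∪ ⁅ e ⁆) (p⊆p∪q ⁅ e ⁆) (≤-reflexive (sym gained)))

  -- The opposite direction: from `X` down to rank zero, the image gains rank at each of the `k`
  -- steps and cannot exceed `rank M′`, which is `rank M`.
  rank-ρ≤corank : ∀ k X → r X ≡ k → M′.r (ρ X) + k ≤ rank M
  rank-ρ≤corank zero    X _   =
    subst (_≤ rank M) (sym (+-identityʳ _)) (≤-trans (M′.r≤rank (ρ X)) (≤-reflexive same-rank))
  rank-ρ≤corank (suc k) X rX≡ =
    let Y , Y⊆X , rY≡ = shrink X rX≡
    in begin
      M′.r (ρ X) + suc k     ≡⟨ +-suc (M′.r (ρ X)) k ⟩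
      suc (M′.r (ρ X)) + k   ≤⟨ +-monoˡ-≤ k (ρ-strict Y X Y⊆X (≤-reflexive (trans (cong suc rY≡) (sym rX≡)))) ⟩
      M′.r (ρ Y) + k         ≤⟨ rank-ρ≤corank k Y rY≡ ⟩
      rank M                 ∎
    where open ≤-Reasoning

  rank-ρ : ∀ X → M′.r (ρ X) + r X ≡ rank M
  rank-ρ X = ≤-antisym (rank-ρ≤corank (r X) X refl) (begin
    rank M                 ≡⟨ sym (m∸n+n≡m (r≤rank X)) ⟩
    rank M ∸ r X + r X     ≤⟨ +-monoˡ-≤ (r X) (corank≤rank-ρ (rank M ∸ r X) X (m∸n+n≡m (r≤rank X))) ⟩
    M′.r (ρ X) + r X       ∎)
    where
    open ≤-Reasoning

  -- The distinct flats ρ Y and ρ (G ∪ x) of equal rank span ρ G, and both lie in ρ x.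
  ρ-descends : ∀ G Y x → G ⊆ Y → r Y ≡ suc (r G) → x ∈ E M → x ∉ closure M Y →
               ρ Y ⊆ ρ ⁅ x ⁆ → ρ G ⊆ ρ ⁅ x ⁆
  ρ-descends G Y x G⊆Y rY≡ x∈E x∉ ρY⊆ρx =
    M′.flat⊇closure K (ρ ⁅ x ⁆) (ρ-isFlat ⁅ x ⁆) K⊆ρx ∘ M′.⊆closure K (ρ G) (ρ⊆E G) K⊆ρG rρG≤rK
    where
    open ≤-Reasoning
    Gx : Subset n
    Gx = G ∪ ⁅ x ⁆
    K : Subset m
    K = ρ Y ∪ ρ Gx
    rGx≡ : r Gx ≡ r Y
    rGx≡ = trans (∉closure⇒gain G x∈E (x∉ ∘ closure-mono G Y G⊆Y)) (sym rY≡)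
    rρY≡ : M′.r (ρ Y) ≡ M′.r (ρ Gx)
    rρY≡ = +-cancelʳ-≡ (r Y) _ _ (begin-equality
      M′.r (ρ Y) + r Y      ≡⟨ rank-ρ Y ⟩
      rank M                ≡⟨ sym (rank-ρ Gx) ⟩
      M′.r (ρ Gx) + r Gx    ≡⟨ cong (M′.r (ρ Gx) +_) rGx≡ ⟩
      M′.r (ρ Gx) + r Y     ∎)
    -- Otherwise `ρ Gx` lies in the flat `ρ Y`; having equal rank, the two coincide, so `x` would be
    -- in `closure M Y`.
    rρY<rK : M′.r (ρ Y) < M′.r K
    rρY<rK = ≰⇒> λ rK≤ →
      let ρGx⊆ρY : ρ Gx ⊆ ρ Y
          ρGx⊆ρY = subst (ρ Gx ⊆_) (ρ-isFlat Y)
            (M′.⊆closure (ρ Y) K (∪-least (ρ⊆E Y) (ρ⊆E Gx)) (p⊆p∪q (ρ Gx)) rK≤ ∘ q⊆p∪q (ρ Y) (ρ Gx))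
      in x∉ (subst (x ∈_) (sym (ρ⊆ρ∧rank≤⇒closure≡ Y Gx ρGx⊆ρY (≤-reflexive rρY≡)))
               (∈⇒∈closure Gx x∈E (q⊆p∪q G ⁅ x ⁆ (x∈⁅x⁆ x))))
    rρG≤rK : M′.r (ρ G) ≤ M′.r K
    rρG≤rK = +-cancelʳ-≤ (r G) _ _ (begin
      M′.r (ρ G) + r G           ≡⟨ rank-ρ G ⟩
      rank M                     ≡⟨ sym (rank-ρ Y) ⟩
      M′.r (ρ Y) + r Y           ≡⟨ cong (M′.r (ρ Y) +_) rY≡ ⟩
      M′.r (ρ Y) + suc (r G)     ≡⟨ +-suc (M′.r (ρ Y)) (r G) ⟩
      suc (M′.r (ρ Y)) + r G     ≤⟨ +-monoˡ-≤ (r G) rρY<rK ⟩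
      M′.r K + r G               ∎)
    K⊆ρG : K ⊆ ρ G
    K⊆ρG = ∪-least (ρ-antitone G Y (closure-mono G Y G⊆Y)) (ρ-antitone G Gx (closure-mono G Gx (p⊆p∪q ⁅ x ⁆)))
    K⊆ρx : K ⊆ ρ ⁅ x ⁆
    K⊆ρx = ∪-least ρY⊆ρx (ρ-antitone ⁅ x ⁆ Gx (closure-mono ⁅ x ⁆ Gx (q⊆p∪q G ⁅ x ⁆)))

  -- Induction on the rank of `Y`. In rank zero `ρ Y` has full rank, hence so has `ρ ⁅ x ⁆`, and `x`
  -- is a loop. Otherwise, if `x` were outside `closure M Y`, `ρ-descends` would pass the inclusion
  -- to some `G ⊆ Y` of smaller rank, giving `x ∈ closure M G`.
  ρ-reflects-element : ∀ k Y x → r Y ≡ k → x ∈ E M → ρ Y ⊆ ρ ⁅ x ⁆ → x ∈ closure M Y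
  ρ-reflects-element zero    Y x rY≡ x∈E ρY⊆ρx =
    ∈closure⁺ Y x∈E (no-gain-mono ⊥ Y x (⊆-min Y) (+-cancelˡ-≤ (M′.r (ρ ⁅ x ⁆)) _ _ (begin
      M′.r (ρ ⁅ x ⁆) + r (⊥ ∪ ⁅ x ⁆)   ≡⟨ cong (λ Z → M′.r (ρ ⁅ x ⁆) + r Z) (∪-identityˡ ⁅ x ⁆) ⟩
      M′.r (ρ ⁅ x ⁆) + r ⁅ x ⁆         ≡⟨ rank-ρ ⁅ x ⁆ ⟩
      rank M                           ≡⟨ sym (rank-ρ Y) ⟩
      M′.r (ρ Y) + r Y                 ≤⟨ +-mono-≤ (M′.rank-mono (ρ Y) (ρ ⁅ x ⁆) ρY⊆ρx) (≤-reflexive (trans rY≡ (sym rank-⊥))) ⟩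
      M′.r (ρ ⁅ x ⁆) + r ⊥             ∎)))
    where open ≤-Reasoning
  ρ-reflects-element (suc k) Y x rY≡ x∈E ρY⊆ρx = decidable-stable (x ∈? closure M Y) λ x∉ →
    let G , G⊆Y , rG≡ = shrink Y rY≡
        ρG⊆ρx = ρ-descends G Y x G⊆Y (trans rY≡ (cong suc (sym rG≡))) x∈E x∉ ρY⊆ρx
    in x∉ (closure-mono G Y G⊆Y (ρ-reflects-element k G x rG≡ x∈E (λ {y} → ρG⊆ρx {y})))

  ρ-reflects : ∀ X Y → X ⊆ E M → ρ Y ⊆ ρ X → X ⊆ closure M Y
  ρ-reflects X Y X⊆E ρY⊆ρX {x} x∈X = ρ-reflects-element (r Y) Y x refl (X⊆E x∈X)
    (ρ-antitone ⁅ x ⁆ X (closure-mono ⁅ x ⁆ X (⁅x⁆⊆p x∈X)) ∘ ρY⊆ρX)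

-- Restrictions and spanning minors.

rank-∖ : (M : Matroid n) (T X : Subset n) → X ⊆ E M ─ T → Rank.r (M ∖ T) X ≡ Rank.r M X
rank-∖ M T X X⊆ =
  let I , (_ , I-ind) , I⊆X , ∣I∣≡ = Rank.basisOf (M ∖ T) X
      J , J-ind , J⊆X , ∣J∣≡ = Rank.basisOf M X
  in ≤-antisym
       (subst (_≤ Rank.r M X) ∣I∣≡ (Rank.indep≤rank M I X I-ind I⊆X))
       (subst (_≤ Rank.r (M ∖ T) X) ∣J∣≡ (Rank.indep≤rank (M ∖ T) J X ((λ x∈J → X⊆ (J⊆X x∈J)) , J-ind) J⊆X))

simple-∖ : (M : Matroid n) (T : Subset n) → IsSimple M → IsSimple (M ∖ T)
simple-∖ M T (no-loops , no-parallel) =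
  (λ e → no-loops e ∘ circuit ⁅ e ⁆) , λ e f e≢f → no-parallel e f e≢f ∘ circuit (⁅ e ⁆ ∪ ⁅ f ⁆)
  where
  circuit : ∀ C → IsCircuit (M ∖ T) C → IsCircuit M C
  circuit C (C⊆ , C-dep , C-min) =
    (λ x∈C → p─q⊆p (E M) T (C⊆ x∈C)) , (λ C-ind → C-dep (C⊆ , C-ind)) , λ D D⊂C → proj₂ (C-min D D⊂C)

-- N is the restriction of M / C to E N, and this restriction has the rank of M / C.
record IsSpanningMinor (M N : Matroid n) (C : Subset n) : Set where
  field
    E⊆E    : E N ⊆ E M
    C⊆E    : C ⊆ E M
    rank-∪ : ∀ X → X ⊆ E N → Rank.r N X + Rank.r M C ≡ Rank.r M (X ∪ C)
    rank-+ : rank N + Rank.r M C ≡ rank M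

-- The adjoint of a spanning minor.

module AdjointOfMinor (M N : Matroid n) (C : Subset n) (minor : IsSpanningMinor M N C)
  (M′ : Matroid m) (φ : Flat M → Flat M′)
  (M′-simple : IsSimple M′) (same-rank : rank M′ ≡ rank M) (φ-injective : Injective _≡_ _≡_ φ)
  (φ-antitone : ∀ F G → value F ⊆ value G → value (φ G) ⊆ value (φ F)) where

  open IsSpanningMinor minor
  open OrderReversing M M′ φ same-rank φ-injective φ-antitone
  private
    module M = Rank M
    module N = Rank N
    module M′ = Rank M′

  σ : Subset n → Subset m
  σ X = ρ (X ∪ C)

  σ-antitone : ∀ X Y → X ⊆ Y → σ Y ⊆ σ X
  σ-antitone X Y X⊆Y = ρ-antitone (X ∪ C) (Y ∪ C) (M.closure-mono (X ∪ C) (Y ∪ C) (∪-mono X⊆Y ⊆-refl))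

  rank-σ : ∀ X → X ⊆ E N → M′.r (σ X) + N.r X ≡ rank N
  rank-σ X X⊆E = +-cancelʳ-≡ (M.r C) _ _ (begin
    M′.r (σ X) + N.r X + M.r C     ≡⟨ +-assoc (M′.r (σ X)) (N.r X) (M.r C) ⟩
    M′.r (σ X) + (N.r X + M.r C)   ≡⟨ cong (M′.r (σ X) +_) (rank-∪ X X⊆E) ⟩
    M′.r (σ X) + M.r (X ∪ C)       ≡⟨ rank-ρ (X ∪ C) ⟩
    rank M                         ≡⟨ sym rank-+ ⟩
    rank N + M.r C                 ∎)
    where open ≡-Reasoning

  rank-∪⁅⁆ : ∀ X e → X ⊆ E N → e ∈ E N → N.r (X ∪ ⁅ e ⁆) + M.r C ≡ M.r ((X ∪ C) ∪ ⁅ e ⁆)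
  rank-∪⁅⁆ X e X⊆E e∈E = trans (rank-∪ (X ∪ ⁅ e ⁆) (p∪⁅x⁆⊆q X⊆E e∈E))
    (cong M.r (trans (∪-assoc X ⁅ e ⁆ C) (∪-swap X ⁅ e ⁆ C)))

  -- By `rank-∪`, passing from `X` in `N` to `X ∪ C` in `M` shifts ranks by the constant `M.r C`, so
  -- `e` raises one rank exactly when it raises the other. With the converse below, `closure N X` is
  -- the trace of `closure M (X ∪ C)` on `E N`.
  closure⇒closure : ∀ X {e} → X ⊆ E N → e ∈ closure N X → e ∈ closure M (X ∪ C)
  closure⇒closure X {e} X⊆E e∈ = let e∈E , ≡rX = N.∈closure⁻ X e∈ in
    M.∈closure⁺ (X ∪ C) (E⊆E e∈E) (≤-reflexive (begin
      M.r ((X ∪ C) ∪ ⁅ e ⁆)     ≡⟨ sym (rank-∪⁅⁆ X e X⊆E e∈E) ⟩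
      N.r (X ∪ ⁅ e ⁆) + M.r C   ≡⟨ cong (_+ M.r C) ≡rX ⟩
      N.r X + M.r C             ≡⟨ rank-∪ X X⊆E ⟩
      M.r (X ∪ C)               ∎))
    where open ≡-Reasoning

  closure⇐closure : ∀ X {e} → X ⊆ E N → e ∈ E N → e ∈ closure M (X ∪ C) → e ∈ closure N X
  closure⇐closure X {e} X⊆E e∈E e∈ = N.∈closure⁺ X e∈E (≤-reflexive (+-cancelʳ-≡ (M.r C) _ _ (begin
    N.r (X ∪ ⁅ e ⁆) + M.r C   ≡⟨ rank-∪⁅⁆ X e X⊆E e∈E ⟩
    M.r ((X ∪ C) ∪ ⁅ e ⁆)     ≡⟨ proj₂ (M.∈closure⁻ (X ∪ C) e∈) ⟩
    M.r (X ∪ C)               ≡⟨ sym (rank-∪ X X⊆E) ⟩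
    N.r X + M.r C             ∎)))
    where open ≡-Reasoning

  σ⊆σ-closure : ∀ X → X ⊆ E N → σ X ⊆ σ (closure N X)
  σ⊆σ-closure X X⊆E = ρ-antitone (closure N X ∪ C) (X ∪ C)
    (M.closure-least (closure N X ∪ C) (X ∪ C)
      (∪-least (closure⇒closure X X⊆E) λ x∈C → M.∈⇒∈closure (X ∪ C) (C⊆E x∈C) (q⊆p∪q X C x∈C)))

  σ-reflects : ∀ X Y → X ⊆ E N → Y ⊆ E N → σ Y ⊆ σ X → X ⊆ closure N Y
  σ-reflects X Y X⊆E Y⊆E σY⊆σX x∈X = closure⇐closure Y Y⊆E (X⊆E x∈X)
    (ρ-reflects (X ∪ C) (Y ∪ C) (∪-least (λ x∈ → E⊆E (X⊆E x∈)) C⊆E) σY⊆σX (p⊆p∪q C x∈X))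

  -- `X` ranges over all generating sets of hyperplanes and not only over flats: `σ X` depends only
  -- on the closure of `X` in `N`, and a search over subsets decides membership. By `rank-σ` each
  -- such `σ X` is a flat of rank one.
  HyperplanePoint : Fin m → Set
  HyperplanePoint p = ∃[ X ] X ⊆ E N × suc (N.r X) ≡ rank N × p ∈ σ X

  hyperplanePoint? : Decidable HyperplanePoint
  hyperplanePoint? p = anySubset? λ X → (X ⊆? E N) ×-dec (suc (N.r X) ≟ rank N) ×-dec (p ∈? σ X)

  P : Subset m
  P = comprehension hyperplanePoint?

  τ : Subset n → Subset m
  τ X = σ X ∩ P

  -- A hyperplane `closure N Y` that contains `X` and avoids `e` has an image `σ Y` of rank one. A
  -- non-loop `p` of `σ Y` spans it, so `p ∈ σ (X ∪ ⁅ e ⁆)` would give `σ Y ⊆ σ (X ∪ ⁅ e ⁆)` and put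
  -- `e` into `closure N Y`.
  separating-point : ∀ X e → X ⊆ E N → e ∈ E N → N.r (X ∪ ⁅ e ⁆) ≡ suc (N.r X) →
                     ∃[ p ] p ∈ τ X × p ∈ E M′ × p ∉ σ (X ∪ ⁅ e ⁆)
  separating-point X e X⊆E e∈E gained =
    let Y , X⊆Y , Y⊆E , rY≡ , e∉ = N.hyperplane-avoiding (rank N ∸ N.r (X ∪ ⁅ e ⁆)) X e
                                     (m∸n+n≡m (N.r≤rank (X ∪ ⁅ e ⁆))) gained X⊆E
        rσY≡1 = +-cancelʳ-≡ (N.r Y) _ 1 (trans (rank-σ Y Y⊆E) (sym rY≡))
        -- Raising the rank from that of `⊥` selects a non-loop; this is why singletons occur as
        -- `⊥ ∪ ⁅ p ⁆`.
        p , p∈σY , p∈E , rp≡ = M′.gain ⊥ (σ Y) (≤-reflexive (trans (cong suc M′.rank-⊥) (sym rσY≡1)))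
        rσY≤rp = ≤-reflexive (trans rσY≡1 (sym (trans rp≡ (cong suc M′.rank-⊥))))
    in p , x∈p∩q⁺ (σ-antitone X Y X⊆Y p∈σY , ∈-comprehension⁺ hyperplanePoint? (Y , Y⊆E , rY≡ , p∈σY)) , p∈E ,
       λ p∈σXe → e∉ (σ-reflects (X ∪ ⁅ e ⁆) Y (p∪⁅x⁆⊆q X⊆E e∈E) Y⊆E
         (λ x∈ → M′.flat⊇closure (⊥ ∪ ⁅ p ⁆) (σ (X ∪ ⁅ e ⁆)) (ρ-isFlat _) (p∪⁅x⁆⊆q (⊆-min _) p∈σXe)
                   (M′.⊆closure (⊥ ∪ ⁅ p ⁆) (σ Y) (ρ⊆E _) (p∪⁅x⁆⊆q (⊆-min _) p∈σY) rσY≤rp x∈))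
         (q⊆p∪q X ⁅ e ⁆ (x∈⁅x⁆ e)))

  -- The point separating `X` from `X ∪ ⁅ e ⁆` lies in `τ X` but outside the flat `σ (X ∪ ⁅ e ⁆)`,
  -- so it raises the rank of `τ (X ∪ ⁅ e ⁆)`.
  corank≤rank-τ : ∀ k X → X ⊆ E N → k + N.r X ≡ rank N → k ≤ M′.r (τ X)
  corank≤rank-τ zero    X X⊆E _     = z≤n
  corank≤rank-τ (suc k) X X⊆E rank≡ =
    let e , e∈E , _ , gained = N.gain X (E N)
          (subst (N.r X <_) (trans rank≡ (sym N.rank-E)) (s≤s (m≤n+m (N.r X) k)))
        p , p∈τX , p∈E , p∉ = separating-point X e X⊆E e∈E gained
    in begin
      suc k                             ≤⟨ s≤s (corank≤rank-τ k (X ∪ ⁅ e ⁆) (p∪⁅x⁆⊆q X⊆E e∈E)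
                                                 (trans (cong (k +_) gained) (trans (+-suc k _) rank≡))) ⟩
      suc (M′.r (τ (X ∪ ⁅ e ⁆)))        ≤⟨ ≰⇒> (λ ≤rτ → p∉ (M′.flat-∋ (σ (X ∪ ⁅ e ⁆)) (ρ-isFlat _) p∈E
                                             (M′.no-gain-mono (τ (X ∪ ⁅ e ⁆)) (σ (X ∪ ⁅ e ⁆)) p (p∩q⊆p _ P) ≤rτ))) ⟩
      M′.r (τ (X ∪ ⁅ e ⁆) ∪ ⁅ p ⁆)      ≤⟨ M′.rank-mono _ (τ X) (p∪⁅x⁆⊆q
                                             (λ x∈ → let x∈σ , x∈P = x∈p∩q⁻ _ P x∈ in
                                               x∈p∩q⁺ (σ-antitone X (X ∪ ⁅ e ⁆) (p⊆p∪q ⁅ e ⁆) x∈σ , x∈P)) p∈τX) ⟩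
      M′.r (τ X)                        ∎
    where open ≤-Reasoning

  -- By `rank-σ` the rank of `σ X` is the corank of `X` in `N`, so the lower bound for `τ X` attains
  -- it; hence `τ X` spans `σ X`.
  rank-τ≡rank-σ : ∀ X → X ⊆ E N → M′.r (τ X) ≡ M′.r (σ X)
  rank-τ≡rank-σ X X⊆E = ≤-antisym (M′.rank-mono (τ X) (σ X) (p∩q⊆p (σ X) P))
    (corank≤rank-τ (M′.r (σ X)) X X⊆E (rank-σ X X⊆E))

  N′ : Matroid m
  N′ = M′ ↾ P

  private module N′ = Rank N′

  τ⊆E : ∀ X → τ X ⊆ E N′
  τ⊆E X x∈ = let x∈σ , x∈P = x∈p∩q⁻ (σ X) P x∈ in x∈p∧x∈q⇒x∈p─[p─q] (E M′) P (ρ⊆E (X ∪ C) x∈σ) x∈P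

  rank-τ : ∀ X → X ⊆ E N → N′.r (τ X) + N.r X ≡ rank N
  rank-τ X X⊆E = trans
    (cong (_+ N.r X) (trans (rank-∖ M′ (E M′ ─ P) (τ X) (τ⊆E X)) (rank-τ≡rank-σ X X⊆E)))
    (rank-σ X X⊆E)

  -- An element of `P` that does not raise the rank of `τ X` does not raise that of the larger `σ X`
  -- either, and so lies in this flat of `M′`.
  τ-isFlat : ∀ X → IsFlat N′ (τ X)
  τ-isFlat X = ⊆-antisym closed λ x∈ → N′.∈⇒∈closure (τ X) (τ⊆E X x∈) x∈
    where
    closed : closure N′ (τ X) ⊆ τ X
    closed {x} x∈ = let x∈E , ≡rτ = N′.∈closure⁻ (τ X) x∈ in x∈p∩q⁺
      ( M′.flat-∋ (σ X) (ρ-isFlat (X ∪ C)) (p─q⊆p (E M′) _ x∈E)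
          (M′.no-gain-mono (τ X) (σ X) x (p∩q⊆p (σ X) P) (≤-reflexive
            (trans (sym (rank-∖ M′ (E M′ ─ P) (τ X ∪ ⁅ x ⁆) (p∪⁅x⁆⊆q (τ⊆E X) x∈E)))
              (trans ≡rτ (rank-∖ M′ (E M′ ─ P) (τ X) (τ⊆E X))))))
      , p─[p─q]⊆q (E M′) P x∈E )

  -- `τ Y` spans `σ Y`, so the flat `σ X` contains `σ Y` once it contains `τ Y`.
  τ-reflects : ∀ X Y → X ⊆ E N → Y ⊆ E N → τ Y ⊆ τ X → X ⊆ closure N Y
  τ-reflects X Y X⊆E Y⊆E τY⊆τX = σ-reflects X Y X⊆E Y⊆E λ x∈ →
    M′.flat⊇closure (τ Y) (σ X) (ρ-isFlat (X ∪ C)) (λ y∈ → p∩q⊆p (σ X) P (τY⊆τX y∈))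
      (M′.⊆closure (τ Y) (σ Y) (ρ⊆E (Y ∪ C)) (p∩q⊆p (σ Y) P) (≤-reflexive (sym (rank-τ≡rank-σ Y Y⊆E))) x∈)

  -- As `⊥ ⊆ X`, each flat `σ X` that contributes to `P` lies in `σ ⊥`. The rank of `N′` can then be
  -- read off from `rank-τ`.
  E≡τ⊥ : E N′ ≡ τ ⊥
  E≡τ⊥ = ⊆-antisym E⊆τ⊥ (τ⊆E ⊥)
    where
    E⊆τ⊥ : E N′ ⊆ τ ⊥
    E⊆τ⊥ x∈E = let x∈P = p─[p─q]⊆q (E M′) P x∈E
                   X , _ , _ , x∈σX = ∈-comprehension⁻ hyperplanePoint? x∈P
               in x∈p∩q⁺ (σ-antitone ⊥ X (⊆-min X) x∈σX , x∈P)

  rank-N′ : rank N′ ≡ rank N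
  rank-N′ = begin
    rank N′                  ≡⟨ sym N′.rank-E ⟩
    N′.r (E N′)              ≡⟨ cong N′.r E≡τ⊥ ⟩
    N′.r (τ ⊥)               ≡⟨ sym (+-identityʳ _) ⟩
    N′.r (τ ⊥) + 0           ≡⟨ cong (N′.r (τ ⊥) +_) (sym N.rank-⊥) ⟩
    N′.r (τ ⊥) + N.r ⊥       ≡⟨ rank-τ ⊥ (⊆-min (E N)) ⟩
    rank N                   ∎
    where open ≡-Reasoning

  ψ : Flat N → Flat N′
  ψ L = τ (value L) ,ᵣ [ τ-isFlat (value L) ]

  flat⊆E : (L : Flat N) → value L ⊆ E N
  flat⊆E L = N.flat⊆E (N.isFlat L)

  ψ-injective : Injective _≡_ _≡_ ψ
  ψ-injective {F} {G} ψF≡ψG = value-injective (⊆-antisym (F⊆G F G ψF≡ψG) (F⊆G G F (sym ψF≡ψG)))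
    where
    F⊆G : ∀ F G → ψ F ≡ ψ G → value F ⊆ value G
    F⊆G F G eq = subst (value F ⊆_) (N.isFlat G)
      (τ-reflects (value F) (value G) (flat⊆E F) (flat⊆E G) (⊆-reflexive (sym (cong value eq))))

  ψ-antitone : ∀ F G → value F ⊆ value G → value (ψ G) ⊆ value (ψ F)
  ψ-antitone F G F⊆G x∈ = let x∈σ , x∈P = x∈p∩q⁻ (σ (value G)) P x∈ in
    x∈p∩q⁺ (σ-antitone (value F) (value G) F⊆G x∈σ , x∈P)

  hyperplane⇒point : ∀ H → IsHyperplane N H → IsPoint N′ (ψ H)
  hyperplane⇒point H H-hyp = trans (sym (N′.r≡rankOf _)) (+-cancelʳ-≡ (N.r (value H)) _ 1
    (trans (rank-τ (value H) (flat⊆E H)) (trans (sym H-hyp) (cong suc (sym (N.r≡rankOf (value H)))))))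

  -- A non-loop `p` of `Q` belongs to `P`, hence to `σ X` for some `X` generating a hyperplane `H`.
  -- Both `ψ H` and `Q` are flats of rank one containing `p`, so each is the closure of `p`.
  -- Uniqueness is injectivity of `ψ`.
  point⇒hyperplane : ∀ Q → IsPoint N′ Q → ∃! _≡_ λ H → IsHyperplane N H × ψ H ≡ Q
  point⇒hyperplane Q Q-point =
    let p , p∈Q , p∈E , rp≡ = N′.gain ⊥ (value Q) (≤-reflexive (trans (cong suc N′.rank-⊥) (sym rQ≡1)))
        rp≡1 = trans rp≡ (cong suc N′.rank-⊥)
        p∈P = p─[p─q]⊆q (E M′) P p∈E
        X , X⊆E , rX≡ , p∈σX = ∈-comprehension⁻ hyperplanePoint? p∈P
        H = N.closureFlat X
        H-hyp = trans (cong suc (trans (sym (N.r≡rankOf (closure N X))) (N.rank-closure X))) rX≡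
        ψH≡Q = value-injective (trans
          (rank-one (value (ψ H)) p (τ-isFlat (value H)) (x∈p∩q⁺ (σ⊆σ-closure X X⊆E p∈σX , p∈P))
            (trans (N′.r≡rankOf _) (hyperplane⇒point H H-hyp)) rp≡1)
          (sym (rank-one (value Q) p (N′.isFlat Q) p∈Q rQ≡1 rp≡1)))
    in H , (H-hyp , ψH≡Q) , λ (_ , ψH′≡Q) → ψ-injective (trans ψH≡Q (sym ψH′≡Q))
    where
    rQ≡1 : N′.r (value Q) ≡ 1
    rQ≡1 = trans (N′.r≡rankOf (value Q)) Q-point
    rank-one : ∀ F p → IsFlat N′ F → p ∈ F → N′.r F ≡ 1 → N′.r (⊥ ∪ ⁅ p ⁆) ≡ 1 → F ≡ closure N′ (⊥ ∪ ⁅ p ⁆)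
    rank-one F p F-flat p∈F rF≡1 rp≡1 = ⊆-antisym
      (N′.⊆closure (⊥ ∪ ⁅ p ⁆) F (N′.flat⊆E F-flat) (p∪⁅x⁆⊆q (⊆-min F) p∈F) (≤-reflexive (trans rF≡1 (sym rp≡1))))
      (N′.flat⊇closure (⊥ ∪ ⁅ p ⁆) F F-flat (p∪⁅x⁆⊆q (⊆-min F) p∈F))

  isAdjoint : IsAdjoint N N′
  isAdjoint = record
    { simple     = simple-∖ M′ (E M′ ─ P) M′-simple
    ; same-rank  = rank-N′
    ; adjointMap = ψ , record
      { injective        = λ {F} {G} → ψ-injective {F} {G}
      ; antitone         = ψ-antitone
      ; hyperplane⇒point = hyperplane⇒point
      ; point⇒hyperplane = point⇒hyperplane
      }
    }

hasAdjoint : (M N : Matroid n) (C : Subset n) →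
             IsSpanningMinor M N C → HasAdjoint M → HasAdjoint N
hasAdjoint M N C minor (m , M′ , adj) = m , N′ , isAdjoint
  where
  open IsAdjoint adj
  open IsAdjointMap (proj₂ adjointMap)
  open AdjointOfMinor M N C minor M′ (proj₁ adjointMap) simple same-rank
         (λ {F} {G} → injective {F} {G}) antitone

-- Equal matroids and deletions as spanning minors.

rank-≈ : (M N : Matroid n) → N ≈ M → ∀ X → Rank.r N X ≡ Rank.r M X
rank-≈ M N (_ , indep⇔) X =
  let I , I-ind , I⊆X , ∣I∣≡ = Rank.basisOf N X
      J , J-ind , J⊆X , ∣J∣≡ = Rank.basisOf M X
  in ≤-antisym
       (subst (_≤ Rank.r M X) ∣I∣≡ (Rank.indep≤rank M I X (Equivalence.to (indep⇔ I) I-ind) I⊆X))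
       (subst (_≤ Rank.r N X) ∣J∣≡ (Rank.indep≤rank N J X (Equivalence.from (indep⇔ J) J-ind) J⊆X))

≈-isSpanningMinor : (M N : Matroid n) → N ≈ M → IsSpanningMinor M N ⊥
≈-isSpanningMinor M N N≈M@(E≡E , _) = record
  { E⊆E    = ⊆-reflexive E≡E
  ; C⊆E    = ⊆-min (E M)
  ; rank-∪ = λ X _ → begin
      Rank.r N X + Rank.r M ⊥   ≡⟨ cong₂ _+_ (rank-≈ M N N≈M X) (Rank.rank-⊥ M) ⟩
      Rank.r M X + 0            ≡⟨ +-identityʳ _ ⟩
      Rank.r M X                ≡⟨ cong (Rank.r M) (sym (∪-identityʳ X)) ⟩
      Rank.r M (X ∪ ⊥)          ∎
  ; rank-+ = begin
      rank N + Rank.r M ⊥       ≡⟨ cong₂ _+_ (sym (Rank.rank-E N)) (Rank.rank-⊥ M) ⟩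
      Rank.r N (E N) + 0        ≡⟨ +-identityʳ _ ⟩
      Rank.r N (E N)            ≡⟨ rank-≈ M N N≈M (E N) ⟩
      Rank.r M (E N)            ≡⟨ cong (Rank.r M) E≡E ⟩
      Rank.r M (E M)            ≡⟨ Rank.rank-E M ⟩
      rank M                    ∎
  }
  where open ≡-Reasoning

-- Contracting a set C ⊆ T that extends a basis of E ─ T to a basis of M does not change the
-- restriction to E ─ T.
∖-isSpanningMinor : (M : Matroid n) (T : Subset n) → ∃[ C ] IsSpanningMinor M (M ∖ T) C
∖-isSpanningMinor M T =
  let J , J-ind , J⊆S , ∣J∣≡ = basisOf S
      K , J⊆K , K⊆E , K-ind , ∣K∣≡ = basisOf⊇ J (E M) J-ind (λ x∈ → p─q⊆p (E M) T (J⊆S x∈))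
  in K ─ J , skew J K J⊆S J⊆K K-ind ∣J∣≡ ∣K∣≡
  where
  open Rank M
  S : Subset _
  S = E M ─ T
  skew : ∀ J K → J ⊆ S → J ⊆ K → Indep M K → ∣ J ∣ ≡ r S → ∣ K ∣ ≡ r (E M) →
         IsSpanningMinor M (M ∖ T) (K ─ J)
  skew J K J⊆S J⊆K K-ind ∣J∣≡ ∣K∣≡ = record
    { E⊆E    = p─q⊆p (E M) T
    ; C⊆E    = λ x∈ → indep⊆E M K-ind (p─q⊆p K J x∈)
    ; rank-∪ = λ X X⊆S → trans (cong₂ _+_ (rank-∖ M T X X⊆S) rC≡)
        (≤-antisym (rX+∣C∣≤ X X⊆S) (rank-∪≤ X C))
    ; rank-+ = begin-equality
        rank (M ∖ T) + r C        ≡⟨ cong₂ _+_ (sym (Rank.rank-E (M ∖ T))) rC≡ ⟩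
        Rank.r (M ∖ T) S + ∣ C ∣  ≡⟨ cong (_+ ∣ C ∣) (rank-∖ M T S ⊆-refl) ⟩
        r S + ∣ C ∣               ≡⟨ rS+∣C∣≡∣K∣ ⟩
        ∣ K ∣                     ≡⟨ ∣K∣≡ ⟩
        r (E M)                   ≡⟨ rank-E ⟩
        rank M                    ∎
    }
    where
    open ≤-Reasoning
    C : Subset _
    C = K ─ J
    rC≡ : r C ≡ ∣ C ∣
    rC≡ = indep⇒rank C (hereditary M K-ind (p─q⊆p K J))
    rS+∣C∣≡∣K∣ : r S + ∣ C ∣ ≡ ∣ K ∣
    rS+∣C∣≡∣K∣ = trans (cong (_+ ∣ C ∣) (sym ∣J∣≡)) (∣q∣+∣p─q∣≡∣p∣ K J J⊆K)
    K⊆S∪C : K ⊆ S ∪ C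
    K⊆S∪C = ∪-least (q⊆p∪q S C) (λ x∈J → p⊆p∪q C (J⊆S x∈J)) ∘ p⊆[p─q]∪q K J
    -- `K` lies in `S ∪ C`, so `C` adds its full size to the rank of `S`; by diminishing returns it
    -- adds no less to that of any `X ⊆ S`.
    rX+∣C∣≤ : ∀ X → X ⊆ S → r X + ∣ C ∣ ≤ r (X ∪ C)
    rX+∣C∣≤ X X⊆S = +-cancelʳ-≤ (r S) _ _ (begin
      r X + ∣ C ∣ + r S       ≡⟨ +-assoc (r X) ∣ C ∣ (r S) ⟩
      r X + (∣ C ∣ + r S)     ≡⟨ cong (r X +_) (trans (+-comm ∣ C ∣ (r S)) rS+∣C∣≡∣K∣) ⟩
      r X + ∣ K ∣             ≤⟨ +-monoʳ-≤ (r X) (indep≤rank K (S ∪ C) K-ind K⊆S∪C) ⟩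
      r X + r (S ∪ C)         ≡⟨ +-comm (r X) _ ⟩
      r (S ∪ C) + r X         ≤⟨ diminishing-returns X S C X⊆S ⟩
      r (X ∪ C) + r S         ∎)

-- Duality and contraction.

∣basis∣≡rank : (M : Matroid n) {B : Subset n} → IsBasis M B → ∣ B ∣ ≡ rank M
∣basis∣≡rank M B-bas = let _ , B₀-bas = ∃basis M in
  ≤-antisym (indep≤basis M (proj₁ B-bas) B₀-bas) (indep≤basis M (proj₁ B₀-bas) B-bas)

-- The formula `r*(X) = |X| + r(E − X) − r(M)`, free of subtraction. Upper bound: an independent set
-- of the dual inside `X` avoids a basis `B`, and `B ─ X` is independent in `E M ─ X`. Lower bound:
-- if a basis `K` extends one of `E M ─ X`, then `X ─ K` is an independent set of the dual of the
-- required size.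
rank-dual : (M : Matroid n) (X : Subset n) → X ⊆ E M →
            Rank.r (dual M) X + rank M ≡ ∣ X ∣ + Rank.r M (E M ─ X)
rank-dual M X X⊆E = ≤-antisym upper lower
  where
  open Rank M
  open ≤-Reasoning
  module D = Rank (dual M)
  upper : D.r X + rank M ≤ ∣ X ∣ + r (E M ─ X)
  upper =
    let I , (B , B-bas , I⊆) , I⊆X , ∣I∣≡ = D.basisOf X
    in begin
      D.r X + rank M                             ≡⟨ cong₂ _+_ (sym ∣I∣≡) (sym (∣basis∣≡rank M B-bas)) ⟩
      ∣ I ∣ + ∣ B ∣                              ≤⟨ +-monoˡ-≤ ∣ B ∣ (p⊆q⇒∣p∣≤∣q∣ λ x∈ →
                                                    x∈p∧x∉q⇒x∈p─q (I⊆X x∈) (x∈p─q⇒x∉q (E M) B (I⊆ x∈))) ⟩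
      ∣ X ─ B ∣ + ∣ B ∣                          ≡⟨ cong (∣ X ─ B ∣ +_) (∣p∣≡∣p∩q∣+∣p─q∣ B X) ⟩
      ∣ X ─ B ∣ + (∣ B ∩ X ∣ + ∣ B ─ X ∣)        ≡⟨ sym (+-assoc ∣ X ─ B ∣ _ _) ⟩
      ∣ X ─ B ∣ + ∣ B ∩ X ∣ + ∣ B ─ X ∣          ≡⟨ cong (λ Z → ∣ X ─ B ∣ + ∣ Z ∣ + ∣ B ─ X ∣) (∩-comm B X) ⟩
      ∣ X ─ B ∣ + ∣ X ∩ B ∣ + ∣ B ─ X ∣          ≡⟨ cong (_+ ∣ B ─ X ∣) (+-comm ∣ X ─ B ∣ _) ⟩
      ∣ X ∩ B ∣ + ∣ X ─ B ∣ + ∣ B ─ X ∣          ≡⟨ cong (_+ ∣ B ─ X ∣) (sym (∣p∣≡∣p∩q∣+∣p─q∣ X B)) ⟩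
      ∣ X ∣ + ∣ B ─ X ∣                          ≤⟨ +-monoʳ-≤ ∣ X ∣ (indep≤rank (B ─ X) (E M ─ X)
                                                    (hereditary M (proj₁ B-bas) (p─q⊆p B X)) λ x∈ →
                                                      x∈p∧x∉q⇒x∈p─q (indep⊆E M (proj₁ B-bas) (p─q⊆p B X x∈)) (x∈p─q⇒x∉q B X x∈)) ⟩
      ∣ X ∣ + r (E M ─ X)                        ∎
  lower : ∣ X ∣ + r (E M ─ X) ≤ D.r X + rank M
  lower =
    let J , J-ind , J⊆ , ∣J∣≡ = basisOf (E M ─ X)
        K , J⊆K , K⊆E , K-ind , ∣K∣≡ = basisOf⊇ J (E M) J-ind (λ x∈ → p─q⊆p (E M) X (J⊆ x∈))
        ∣K∣≡rank = trans ∣K∣≡ rank-E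
        K-bas = large-indep⇒basis M K-ind (proj₂ (∃basis M)) (≤-reflexive (sym ∣K∣≡rank))
    in begin
      ∣ X ∣ + r (E M ─ X)                        ≡⟨ cong₂ _+_ (∣p∣≡∣p∩q∣+∣p─q∣ X K) (sym ∣J∣≡) ⟩
      ∣ X ∩ K ∣ + ∣ X ─ K ∣ + ∣ J ∣              ≤⟨ +-monoʳ-≤ (∣ X ∩ K ∣ + ∣ X ─ K ∣) (p⊆q⇒∣p∣≤∣q∣ λ x∈ →
                                                    x∈p∧x∉q⇒x∈p─q (J⊆K x∈) (x∈p─q⇒x∉q (E M) X (J⊆ x∈))) ⟩
      ∣ X ∩ K ∣ + ∣ X ─ K ∣ + ∣ K ─ X ∣          ≡⟨ cong (_+ ∣ K ─ X ∣) (+-comm ∣ X ∩ K ∣ _) ⟩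
      ∣ X ─ K ∣ + ∣ X ∩ K ∣ + ∣ K ─ X ∣          ≡⟨ +-assoc ∣ X ─ K ∣ _ _ ⟩
      ∣ X ─ K ∣ + (∣ X ∩ K ∣ + ∣ K ─ X ∣)        ≡⟨ cong (λ Z → ∣ X ─ K ∣ + (∣ Z ∣ + ∣ K ─ X ∣)) (∩-comm X K) ⟩
      ∣ X ─ K ∣ + (∣ K ∩ X ∣ + ∣ K ─ X ∣)        ≡⟨ cong (∣ X ─ K ∣ +_) (trans (sym (∣p∣≡∣p∩q∣+∣p─q∣ K X)) ∣K∣≡rank) ⟩
      ∣ X ─ K ∣ + rank M                         ≤⟨ +-monoˡ-≤ (rank M) (D.indep≤rank (X ─ K) X
                                                    (K , K-bas , λ x∈ → x∈p∧x∉q⇒x∈p─q (X⊆E (p─q⊆p X K x∈)) (x∈p─q⇒x∉q X K x∈))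
                                                    (p─q⊆p X K)) ⟩
      D.r X + rank M                             ∎

-- `M / T` is the dual of `D`, which is `dual M ∖ T`. So `rank-dual` is applied to `D` at `X` and to
-- `M` at `S` and `S ─ X`, whose complements in `E M` are `T` and `X ∪ T`; the sizes of the sets
-- then cancel.
rank-/ : (M : Matroid n) (T X : Subset n) → T ⊆ E M → X ⊆ E M ─ T →
         Rank.r (M / T) X + Rank.r M T ≡ Rank.r M (X ∪ T)
rank-/ M T X T⊆E X⊆S = +-cancelʳ-≡ ∣ S ∣ _ _ (begin
  Q.r X + r T + ∣ S ∣                     ≡⟨ +-assoc (Q.r X) (r T) ∣ S ∣ ⟩
  Q.r X + (r T + ∣ S ∣)                   ≡⟨ cong (Q.r X +_) (+-comm (r T) ∣ S ∣) ⟩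
  Q.r X + (∣ S ∣ + r T)                   ≡⟨ cong (Q.r X +_) (sym rank-D) ⟩
  Q.r X + (rank D + rank M)               ≡⟨ sym (+-assoc (Q.r X) (rank D) (rank M)) ⟩
  Q.r X + rank D + rank M                 ≡⟨ cong (_+ rank M) (rank-dual D X X⊆S) ⟩
  ∣ X ∣ + Rank.r D (S ─ X) + rank M       ≡⟨ +-assoc ∣ X ∣ _ (rank M) ⟩
  ∣ X ∣ + (Rank.r D (S ─ X) + rank M)     ≡⟨ cong (∣ X ∣ +_) rank-D-S─X ⟩
  ∣ X ∣ + (∣ S ─ X ∣ + r (X ∪ T))         ≡⟨ sym (+-assoc ∣ X ∣ _ _) ⟩
  ∣ X ∣ + ∣ S ─ X ∣ + r (X ∪ T)           ≡⟨ cong (_+ r (X ∪ T)) (∣q∣+∣p─q∣≡∣p∣ S X X⊆S) ⟩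
  ∣ S ∣ + r (X ∪ T)                       ≡⟨ +-comm ∣ S ∣ _ ⟩
  r (X ∪ T) + ∣ S ∣                       ∎)
  where
  open ≡-Reasoning
  open Rank M
  S : Subset _
  S = E M ─ T
  D : Matroid _
  D = dual M ∖ T
  module Q = Rank (M / T)
  rank-D : rank D + rank M ≡ ∣ S ∣ + r T
  rank-D = begin
    rank D + rank M                ≡⟨ cong (_+ rank M) (sym (Rank.rank-E D)) ⟩
    Rank.r D S + rank M            ≡⟨ cong (_+ rank M) (rank-∖ (dual M) T S ⊆-refl) ⟩
    Rank.r (dual M) S + rank M     ≡⟨ rank-dual M S (p─q⊆p (E M) T) ⟩
    ∣ S ∣ + r (E M ─ S)            ≡⟨ cong (λ Z → ∣ S ∣ + r Z) (p─[p─q]≡q (E M) T T⊆E) ⟩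
    ∣ S ∣ + r T                    ∎
  rank-D-S─X : Rank.r D (S ─ X) + rank M ≡ ∣ S ─ X ∣ + r (X ∪ T)
  rank-D-S─X = begin
    Rank.r D (S ─ X) + rank M            ≡⟨ cong (_+ rank M) (rank-∖ (dual M) T (S ─ X) (p─q⊆p S X)) ⟩
    Rank.r (dual M) (S ─ X) + rank M     ≡⟨ rank-dual M (S ─ X) (λ x∈ → p─q⊆p (E M) T (p─q⊆p S X x∈)) ⟩
    ∣ S ─ X ∣ + r (E M ─ (S ─ X))        ≡⟨ cong (λ Z → ∣ S ─ X ∣ + r (E M ─ Z)) S─X≡E─[X∪T] ⟩
    ∣ S ─ X ∣ + r (E M ─ (E M ─ (X ∪ T)))  ≡⟨ cong (λ Z → ∣ S ─ X ∣ + r Z) (p─[p─q]≡q (E M) (X ∪ T) X∪T⊆E) ⟩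
    ∣ S ─ X ∣ + r (X ∪ T)                ∎
    where
    S─X≡E─[X∪T] : S ─ X ≡ E M ─ (X ∪ T)
    S─X≡E─[X∪T] = trans (p─q─r≡p─q∪r (E M) T X) (cong (E M ─_) (∪-comm T X))
    X∪T⊆E : X ∪ T ⊆ E M
    X∪T⊆E = ∪-least (λ x∈ → p─q⊆p (E M) T (X⊆S x∈)) T⊆E

/-isSpanningMinor : (M : Matroid n) (T : Subset n) → T ⊆ E M → IsSpanningMinor M (M / T) T
/-isSpanningMinor M T T⊆E = record
  { E⊆E    = p─q⊆p (E M) T
  ; C⊆E    = T⊆E
  ; rank-∪ = λ X → rank-/ M T X T⊆E
  ; rank-+ = begin
      rank (M / T) + r T            ≡⟨ cong (_+ r T) (sym (Rank.rank-E (M / T))) ⟩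
      Rank.r (M / T) S + r T        ≡⟨ rank-/ M T S T⊆E ⊆-refl ⟩
      r (S ∪ T)                     ≡⟨ cong r (⊆-antisym (∪-least (p─q⊆p (E M) T) T⊆E) (p⊆[p─q]∪q (E M) T)) ⟩
      r (E M)                       ≡⟨ rank-E ⟩
      rank M                        ∎
  }
  where
  open ≡-Reasoning
  open Rank M
  S : Subset _
  S = E M ─ T

-- Induction on the sequence of deletions and contractions: each operation yields a spanning minor
-- of the matroid before it, which therefore inherits an adjoint.
theorem3p4 : (n : ℕ) (M N : Matroid n) → HasAdjoint M → N IsMinorOf M → HasAdjoint N
theorem3p4 n M N adj (equal N≈M) = hasAdjoint M N ⊥ (≈-isSpanningMinor M N N≈M) adj
theorem3p4 n M N adj (delete T _ minor) =
  let C , C-minor = ∖-isSpanningMinor M T in theorem3p4 n (M ∖ T) N (hasAdjoint M (M ∖ T) C C-minor adj) minor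
theorem3p4 n M N adj (contract T T⊆E minor) =
  theorem3p4 n (M / T) N (hasAdjoint M (M / T) T (/-isSpanningMinor M T T⊆E) adj) minor
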